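{- Let $s,t,q,N$ be integers with $0\le s<q$, $1\le t<q$, $N\ge0$, $t\nmid q$ and $\gcd(t,q)=1$. Write $q=\overline qt+\widehat q$ ($1\le\widehat q<t$), $s=\overline st+\widehat s$ ($0\le\widehat s<t$). Let $S^-(s,t,q,N)=\sum_{k=0}^N\lfloor(s-kt)/q\rfloor$, $M=-\lfloor(s-Nt)/q\rfloor$, $x_M=(s+(M-1)q)/t$ and $S=-\overline q\frac{(M-1)M}2-M(N-\lfloor x_M\rfloor)$. Let $H=\{k\in\mathbb N:(\widehat s+k\widehat q)\bmod t<\widehat q\}$, $J=H\cap\{0,\dots,t-1\}=\{j_0<\dots<j_{\widehat q-1}\}$, and $S_K=\sum_{k\in K}k$. Then: (a) if $j_0\ge M$, $S^-(s,t,q,N)=S$; (b.1) if $j_0<M\le j_{\widehat q-1}$, $S^-(s,t,q,N)=S-S_K$ with $K=H\cap\{0,\dots,M-1\}$; (b.2) if $j_{\widehat q-1}<M$ and $j_0+t\ge M$, $S^-(s,t,q,N)=S-S_J$; (b.3) if $j_{\widehat q-1}<M$ and $j_0+t<M$, with $u=\lfloor(M-1)/t\rfloor$ and $K=H\cap\{ut,\dots,M-1\}$, $S^-(s,t,q,N)=S-uS_J-\widehat q\,t\frac{(u-1)u}2-S_K$.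
   Context: Here $r\bmod t$ denotes the representative of $r$ in $\{0,\dots,t-1\}$. -}

module Defs where

open import Data.Fin as Fin using (Fin)
open import Data.Integer as ℤ using (ℤ; +_; -[1+_])
open import Data.List using (List; []; map; foldr; filter; upTo)
open import Data.List.Membership.Propositional using (_∈_)
open import Data.Nat as ℕ using (ℕ; suc; NonZero; _%_)
open import Data.Product using (∃; _×_)
open import Data.Rational.Unnormalised using (_/_; floor)
open import Function.Bundles using (_⇔_)
open import Relation.Binary.Core using (_Preserves_⟶_)
open import Relation.Binary.PropositionalEquality using (_≡_)
open import Relation.Nullary using (Dec)

sumℤ : List ℤ → ℤ
sumℤ = foldr ℤ._+_ ℤ.0ℤ

S⁻ : (s t q N : ℕ) .{{_ : NonZero q}} → ℤ
S⁻ s t q N = sumℤ (map (λ k → floor ((+ s ℤ.- + k ℤ.* + t) / q)) (upTo (suc N)))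

H : (ŝ q̂ t : ℕ) .{{_ : NonZero t}} → ℕ → Set
H ŝ q̂ t k = (ŝ ℕ.+ k ℕ.* q̂) % t ℕ.< q̂

H? : ∀ ŝ q̂ t .{{_ : NonZero t}} k → Dec (H ŝ q̂ t k)
H? ŝ q̂ t k = (ŝ ℕ.+ k ℕ.* q̂) % t ℕ.<? q̂

below : ℤ → List ℕ
below (+ n)    = upTo n
below -[1+ _ ] = []

-- The naturals k with a ≤ k < b, each listed once; the bounds are integers
-- because M and u are defined as integers.
range : ℤ → ℤ → List ℕ
range a b = filter (λ k → a ℤ.≤? + k) (below b)

-- H ∩ {a, …, b - 1}
H∩ : (ŝ q̂ t : ℕ) .{{_ : NonZero t}} → (a b : ℤ) → List ℕ
H∩ ŝ q̂ t a b = filter (H? ŝ q̂ t) (range a b)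

-- A = {j₀ < ⋯ < jₙ₋₁}; in particular A has exactly n elements.
_EnumeratesIncreasingly_ : ∀ {n} → (Fin n → ℕ) → List ℕ → Set
j EnumeratesIncreasingly A =
  j Preserves Fin._<_ ⟶ ℕ._<_ × (∀ k → k ∈ A ⇔ ∃ λ i → j i ≡ k)

{-# OPTIONS --safe #-}
-- Put c k = ⌈(k t - s) / q⌉ and f i = ⌊(s + i q) / t⌋. Counting the lattice points
-- between the line and the axes by columns and by rows gives
-- Σ_{k ≤ N} c k + Σ_{i < M} f i = M N. The step from f (k - 1) to f k is q̄, plus a
-- carry exactly when k ∈ H, so by partial summation
-- Σ_{i < M} f i = M f (M - 1) - q̄ M (M - 1) / 2 - Σ (H ∩ {0, …, M - 1}).
-- Hence S⁻ = S - Σ (H ∩ {0, …, M - 1}) in every case, and the cases only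
-- evaluate the last sum, using that H is t-periodic with q̂ elements per period
-- (the number of carries in one period).
module Submission where

open import Defs
open import Data.Bool using (true; false)
open import Data.Fin as Fin using (Fin; fromℕ<; opposite; toℕ)
import Data.Fin.Properties as Fin
open import Data.Integer as ℤ using (ℤ; +_; -[1+_]; -_; _+_; _-_; _*_; _≤_; _<_; _≥_; 0ℤ; 1ℤ; _/ℕ_)
import Data.Integer.DivMod as ℤ
import Data.Integer.Properties as ℤ
import Data.Integer.Tactic.RingSolver as ℤ-Solver
open import Data.List using (List; []; _∷_; _∷ʳ_; _++_; length; lookup; map; filter; upTo; applyUpTo)
open import Data.List.Membership.Propositional using (_∈_)
open import Data.List.Membership.Propositional.Properties
  using (∈-filter⁺; ∈-filter⁻; ∈-upTo⁺; ∈-upTo⁻; ∈-lookup)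
open import Data.List.Properties
  using (filter-++; filter-accept; filter-all; filter-none; filter-reject; filter-≐; length-++; length-map;
         map-++; map-upTo; upTo-∷ʳ; ++-identityʳ)
import Data.List.Relation.Unary.All as All
import Data.List.Relation.Unary.All.Properties as All
open import Data.List.Relation.Unary.AllPairs using (AllPairs; _∷_)
import Data.List.Relation.Unary.AllPairs.Properties as AllPairs
open import Data.List.Relation.Unary.Any using (index)
open import Data.List.Relation.Unary.Any.Properties using (lookup-index)
open import Data.Nat as ℕ using (ℕ; NonZero; zero; suc; z≤n; s≤s; _%_)
open import Data.Nat.Divisibility using (_∣_; n∣m*n)
open import Data.Nat.DivMod
  using (m≡m%n+[m/n]*n; m%n<n; [m+kn]%n≡m%n; m<n⇒m%n≡m; m<n⇒m/n≡0; m*n/n≡m; +-distrib-/-∣ʳ)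
open import Data.Nat.GCD using (gcd)
open import Data.Nat.ListAction using (sum)
open import Data.Nat.ListAction.Properties using (sum-++)
import Data.Nat.Properties as ℕ
open import Algebra.Properties.CommutativeSemigroup ℕ.+-commutativeSemigroup using (xy∙z≈xz∙y)
open import Data.Nat.Tactic.RingSolver using (solve-∀)
open import Data.Product using (∃; _×_; _,_; proj₁; proj₂)
open import Data.Rational.Unnormalised using (ℚᵘ; _/_; floor)
open import Data.Sum using (_⊎_; inj₁; inj₂; [_,_]′)
open import Function using (_∋_; _∘_; id)
open import Function.Bundles using (Equivalence; mk⇔)
open import Relation.Binary.PropositionalEquality hiding (J)
open import Relation.Nullary using (¬_; yes; no; does; contradiction)
open import Relation.Unary using (Decidable; _≐_)

-- Division

[m+kn]/n≡m/n+k : ∀ m k n .{{_ : NonZero n}} → (m ℕ.+ k ℕ.* n) ℕ./ n ≡ m ℕ./ n ℕ.+ k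
[m+kn]/n≡m/n+k m k n =
  trans (+-distrib-/-∣ʳ m (n∣m*n k)) (cong (m ℕ./ n ℕ.+_) (m*n/n≡m k n))

divMod-unique : ∀ {n r} k t .{{_ : NonZero t}} → r ℕ.< t → n ≡ r ℕ.+ k ℕ.* t →
                n ℕ./ t ≡ k × n % t ≡ r
divMod-unique {r = r} k t r<t refl =
  trans ([m+kn]/n≡m/n+k r k t) (cong (ℕ._+ k) (m<n⇒m/n≡0 r<t)) ,
  trans ([m+kn]%n≡m%n r k t) (m<n⇒m%n≡m r<t)

-- If `a % t + b` stays below `t`, it is the new remainder and is at least `b`. Otherwise the new
-- remainder is `a % t + b - t`, which is below `b` because `a % t < t`. So comparing the new
-- remainder with `b` detects the carry.
carry : ∀ a {b t} .{{_ : NonZero t}} → b ℕ.< t →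
        ((a ℕ.+ b) % t ℕ.< b × (a ℕ.+ b) ℕ./ t ≡ suc (a ℕ./ t)) ⊎
        (¬ (a ℕ.+ b) % t ℕ.< b × (a ℕ.+ b) ℕ./ t ≡ a ℕ./ t)
carry a {b} {t} b<t with a % t ℕ.+ b ℕ.<? t
... | yes lt = inj₂ (subst (λ x → ¬ x ℕ.< b) (sym (proj₂ unique)) (ℕ.≤⇒≯ (ℕ.m≤n+m b (a % t))) , proj₁ unique)
  where
  unique : (a ℕ.+ b) ℕ./ t ≡ a ℕ./ t × (a ℕ.+ b) % t ≡ a % t ℕ.+ b
  unique = divMod-unique (a ℕ./ t) t lt
    (trans (cong (ℕ._+ b) (m≡m%n+[m/n]*n a t)) (xy∙z≈xz∙y (a % t) _ b))
... | no ¬lt = inj₁ (subst (ℕ._< b) (sym (proj₂ unique)) r<b , proj₁ unique)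
  where
  r : ℕ
  r = a % t ℕ.+ b ℕ.∸ t
  r+t : r ℕ.+ t ≡ a % t ℕ.+ b
  r+t = ℕ.m∸n+n≡m (ℕ.≮⇒≥ ¬lt)
  r<b : r ℕ.< b
  r<b = ℕ.+-cancelʳ-< t r b (begin-strict
    r ℕ.+ t      ≡⟨ r+t ⟩
    a % t ℕ.+ b  <⟨ ℕ.+-monoˡ-< b (m%n<n a t) ⟩
    t ℕ.+ b      ≡⟨ ℕ.+-comm t b ⟩
    b ℕ.+ t      ∎)
    where open ℕ.≤-Reasoning
  unique : (a ℕ.+ b) ℕ./ t ≡ suc (a ℕ./ t) × (a ℕ.+ b) % t ≡ r
  unique = divMod-unique (suc (a ℕ./ t)) t (ℕ.<-trans r<b b<t) (begin
    a ℕ.+ b                                ≡⟨ cong (ℕ._+ b) (m≡m%n+[m/n]*n a t) ⟩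
    a % t ℕ.+ a ℕ./ t ℕ.* t ℕ.+ b          ≡⟨ xy∙z≈xz∙y (a % t) _ b ⟩
    a % t ℕ.+ b ℕ.+ a ℕ./ t ℕ.* t          ≡⟨ cong (ℕ._+ a ℕ./ t ℕ.* t) r+t ⟨
    r ℕ.+ t ℕ.+ a ℕ./ t ℕ.* t              ≡⟨ ℕ.+-assoc r t _ ⟩
    r ℕ.+ suc (a ℕ./ t) ℕ.* t              ∎)
    where open ≡-Reasoning

-- `floor` divides by the denominator as an integer. Once `d` is visibly a successor, this is
-- division by a positive integer, where the two quotients agree.
floor-/ : ∀ i d .{{_ : NonZero d}} → floor (i / d) ≡ i /ℕ d
floor-/ i d@(suc _) = ℤ.div-pos-is-/ℕ i d

-- The triangular number 0 + 1 + ⋯ + (n - 1) = (n - 1) n / 2, kept free of division so that the ring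
-- solver can treat it as an atom.
T : ℕ → ℕ
T zero    = 0
T (suc n) = T n ℕ.+ n

2T : ∀ n → T (suc n) ℕ.* 2 ≡ n ℕ.* suc n
2T zero    = refl
2T (suc n) = begin
  (T (suc n) ℕ.+ suc n) ℕ.* 2      ≡⟨ ℕ.*-distribʳ-+ 2 (T (suc n)) (suc n) ⟩
  T (suc n) ℕ.* 2 ℕ.+ suc n ℕ.* 2  ≡⟨ cong (ℕ._+ suc n ℕ.* 2) (2T n) ⟩
  n ℕ.* suc n ℕ.+ suc n ℕ.* 2      ≡⟨ expand n ⟩
  suc n ℕ.* suc (suc n)            ∎
  where
  open ≡-Reasoning
  expand : ∀ n → n ℕ.* suc n ℕ.+ suc n ℕ.* 2 ≡ suc n ℕ.* suc (suc n)
  expand = solve-∀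

[n-1]n/2≡T : ∀ n → ((+ n - 1ℤ) * + n) /ℕ 2 ≡ + T n
[n-1]n/2≡T zero    = refl
[n-1]n/2≡T (suc n) = begin
  (+ n * + suc n) /ℕ 2       ≡⟨ cong (_/ℕ 2) (ℤ.pos-* n (suc n)) ⟨
  + (n ℕ.* suc n ℕ./ 2)      ≡⟨ cong (λ m → + (m ℕ./ 2)) (2T n) ⟨
  + (T (suc n) ℕ.* 2 ℕ./ 2)  ≡⟨ cong +_ (m*n/n≡m (T (suc n)) 2) ⟩
  + T (suc n)                ∎
  where open ≡-Reasoning

-- Sums and filters over initial segments

sumUpTo : (ℕ → ℕ) → ℕ → ℕ
sumUpTo f n = sum (map f (upTo n))

sum-∷ʳ : ∀ xs x → sum (xs ∷ʳ x) ≡ sum xs ℕ.+ x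
sum-∷ʳ xs x = trans (sum-++ xs (x ∷ [])) (cong (sum xs ℕ.+_) (ℕ.+-identityʳ x))

sumUpTo-suc : ∀ f n → sumUpTo f (suc n) ≡ sumUpTo f n ℕ.+ f n
sumUpTo-suc f n = begin
  sum (map f (upTo (suc n)))   ≡⟨ cong (sum ∘ map f) (upTo-∷ʳ n) ⟨
  sum (map f (upTo n ∷ʳ n))    ≡⟨ cong sum (map-++ f (upTo n) (n ∷ [])) ⟩
  sum (map f (upTo n) ∷ʳ f n)  ≡⟨ sum-∷ʳ (map f (upTo n)) (f n) ⟩
  sumUpTo f n ℕ.+ f n          ∎
  where open ≡-Reasoning

sumℤ-neg : ∀ {g : ℕ → ℤ} {c : ℕ → ℕ} → (∀ k → g k ≡ - + c k) →
           ∀ xs → sumℤ (map g xs) ≡ - + sum (map c xs)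
sumℤ-neg g≡-c []       = refl
sumℤ-neg {g} {c} g≡-c (x ∷ xs) = begin
  g x + sumℤ (map g xs)            ≡⟨ cong₂ _+_ (g≡-c x) (sumℤ-neg g≡-c xs) ⟩
  - + c x + - + sum (map c xs)     ≡⟨ ℤ.neg-distrib-+ (+ c x) (+ sum (map c xs)) ⟨
  - (+ c x + + sum (map c xs))     ∎
  where open ≡-Reasoning

sum-map-+ : ∀ a xs → sum (map (a ℕ.+_) xs) ≡ length xs ℕ.* a ℕ.+ sum xs
sum-map-+ a []       = refl
sum-map-+ a (x ∷ xs) = trans (cong (a ℕ.+ x ℕ.+_) (sum-map-+ a xs)) (swap a x (length xs ℕ.* a) (sum xs))
  where
  swap : ∀ a x l s → a ℕ.+ x ℕ.+ (l ℕ.+ s) ≡ a ℕ.+ l ℕ.+ (x ℕ.+ s)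
  swap = solve-∀

upTo-+ : ∀ m n → upTo (m ℕ.+ n) ≡ upTo m ++ map (m ℕ.+_) (upTo n)
upTo-+ m n = trans (applyUpTo-+ id m) (cong (upTo m ++_) (sym (map-upTo (m ℕ.+_) n)))
  where
  -- The function has to vary, since each induction step on `m` shifts it by `suc`.
  applyUpTo-+ : ∀ (f : ℕ → ℕ) m → applyUpTo f (m ℕ.+ n) ≡ applyUpTo f m ++ applyUpTo (f ∘ (m ℕ.+_)) n
  applyUpTo-+ f zero    = refl
  applyUpTo-+ f (suc m) = cong (f 0 ∷_) (applyUpTo-+ (f ∘ suc) m)

module _ {p} {P : ℕ → Set p} (P? : Decidable P) where

  filter-map : ∀ (f : ℕ → ℕ) xs → filter P? (map f xs) ≡ map f (filter (P? ∘ f) xs)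
  filter-map f []       = refl
  filter-map f (x ∷ xs) with does (P? (f x))
  ... | true = cong (f x ∷_) (filter-map f xs)
  ... | false = filter-map f xs

  filter-upTo-+ : ∀ m n → filter P? (upTo (m ℕ.+ n)) ≡
                  filter P? (upTo m) ++ filter P? (map (m ℕ.+_) (upTo n))
  filter-upTo-+ m n = trans (cong (filter P?) (upTo-+ m n)) (filter-++ P? (upTo m) _)

  filter-upTo-suc : ∀ n → filter P? (upTo (suc n)) ≡ filter P? (upTo n) ++ filter P? (n ∷ [])
  filter-upTo-suc n = trans (cong (filter P?) (sym (upTo-∷ʳ n))) (filter-++ P? (upTo n) (n ∷ []))

  filter-upTo-accept : ∀ {n} → P n → filter P? (upTo (suc n)) ≡ filter P? (upTo n) ∷ʳ n
  filter-upTo-accept {n} Pn =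
    trans (filter-upTo-suc n) (cong (filter P? (upTo n) ++_) (filter-accept P? Pn))

  filter-upTo-reject : ∀ {n} → ¬ P n → filter P? (upTo (suc n)) ≡ filter P? (upTo n)
  filter-upTo-reject {n} ¬Pn = begin
    filter P? (upTo (suc n))                  ≡⟨ filter-upTo-suc n ⟩
    filter P? (upTo n) ++ filter P? (n ∷ [])  ≡⟨ cong (filter P? (upTo n) ++_) (filter-reject P? ¬Pn) ⟩
    filter P? (upTo n) ++ []                  ≡⟨ ++-identityʳ _ ⟩
    filter P? (upTo n)                        ∎
    where open ≡-Reasoning

  filter-upTo-truncate : ∀ {m n} → m ℕ.≤ n → (∀ k → m ℕ.≤ k → k ℕ.< n → ¬ P k) →
                         filter P? (upTo n) ≡ filter P? (upTo m)
  filter-upTo-truncate {m} {n} m≤n ¬P = begin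
    filter P? (upTo n)                             ≡⟨ cong (filter P? ∘ upTo) (ℕ.m+[n∸m]≡n m≤n) ⟨
    filter P? (upTo (m ℕ.+ d))                     ≡⟨ filter-upTo-+ m d ⟩
    filter P? (upTo m) ++ filter P? (map (m ℕ.+_) (upTo d))
      ≡⟨ cong (filter P? (upTo m) ++_) (filter-none P? (All.map⁺ (All.map none (All.all-upTo d)))) ⟩
    filter P? (upTo m) ++ []                       ≡⟨ ++-identityʳ _ ⟩
    filter P? (upTo m)                             ∎
    where
    open ≡-Reasoning
    d : ℕ
    d = n ℕ.∸ m
    none : ∀ {k} → k ℕ.< d → ¬ P (m ℕ.+ k)
    none {k} k<d = ¬P (m ℕ.+ k) (ℕ.m≤m+n m k)
      (subst (m ℕ.+ k ℕ.<_) (ℕ.m+[n∸m]≡n m≤n) (ℕ.+-monoʳ-< m k<d))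

range-0 : ∀ n → range 0ℤ (+ n) ≡ upTo n
range-0 n = filter-all _ (All.universal (λ _ → ℤ.+≤+ z≤n) (upTo n))

range-+ : ∀ a n → range (+ a) (+ (a ℕ.+ n)) ≡ map (a ℕ.+_) (upTo n)
range-+ a n = begin
  filter a≤? (upTo (a ℕ.+ n))                                ≡⟨ filter-upTo-+ a≤? a n ⟩
  filter a≤? (upTo a) ++ filter a≤? (map (a ℕ.+_) (upTo n))
    ≡⟨ cong₂ _++_ (filter-none a≤? (All.map (λ k<a → ℕ.<⇒≱ k<a ∘ ℤ.drop‿+≤+) (All.all-upTo a)))
                  (filter-all a≤? (All.map⁺ (All.universal (λ k → ℤ.+≤+ (ℕ.m≤m+n a k)) (upTo n)))) ⟩
  map (a ℕ.+_) (upTo n)                                      ∎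
  where
  open ≡-Reasoning
  a≤? : Decidable (λ k → + a ≤ + k)
  a≤? k = + a ℤ.≤? + k

-- Increasing enumerations

lookup-< : ∀ {xs} → AllPairs ℕ._<_ xs → ∀ {i j} → i Fin.< j → lookup xs i ℕ.< lookup xs j
lookup-< (x<xs ∷ _)   {Fin.zero}  {Fin.suc j} _         = All.lookup x<xs (∈-lookup j)
lookup-< (_ ∷ sorted) {Fin.suc i} {Fin.suc j} (s≤s i<j) = lookup-< sorted i<j

enumerate : ∀ {n xs} → AllPairs ℕ._<_ xs → length xs ≡ n → ∃ λ (j : Fin n → ℕ) → j EnumeratesIncreasingly xs
enumerate {xs = xs} sorted refl = lookup xs , lookup-< sorted , λ k →
  mk⇔ (λ k∈xs → index k∈xs , sym (lookup-index k∈xs)) (λ { (i , refl) → ∈-lookup i })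

module _ {n} (0<n : 0 ℕ.< n) {j : Fin n → ℕ} {xs} (enum : j EnumeratesIncreasingly xs) where

  private
    first : Fin n
    first = fromℕ< 0<n

    mono : ∀ {i i′} → i Fin.≤ i′ → j i ℕ.≤ j i′
    mono i≤i′ with ℕ.m≤n⇒m<n∨m≡n i≤i′
    ... | inj₁ i<i′ = ℕ.<⇒≤ (proj₁ enum i<i′)
    ... | inj₂ i≡i′ = ℕ.≤-reflexive (cong j (Fin.toℕ-injective i≡i′))

  first-∈ : j first ∈ xs
  first-∈ = Equivalence.from (proj₂ enum (j first)) (first , refl)

  first-min : ∀ {k} → k ∈ xs → j first ℕ.≤ k
  first-min {k} k∈xs with i , refl ← Equivalence.to (proj₂ enum k) k∈xs =
    mono (subst (ℕ._≤ toℕ i) (sym (Fin.toℕ-fromℕ< 0<n)) z≤n)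

  last-max : ∀ {k} → k ∈ xs → k ℕ.≤ j (opposite first)
  last-max {k} k∈xs with i , refl ← Equivalence.to (proj₂ enum k) k∈xs = mono (begin
    -- The largest index is `n - 1`, which is the value of `opposite first` because `first` has
    -- value 0.
    toℕ i                   ≤⟨ ℕ.∸-monoˡ-≤ 1 (Fin.toℕ<n i) ⟩
    n ℕ.∸ 1                 ≡⟨ cong (λ m → n ℕ.∸ suc m) (Fin.toℕ-fromℕ< 0<n) ⟨
    n ℕ.∸ suc (toℕ first)   ≡⟨ Fin.opposite-prop first ⟨
    toℕ (opposite first)    ∎)
    where open ℕ.≤-Reasoning

-- The set H

module _ (ŝ q̂ t : ℕ) .{{_ : NonZero t}} (q̂<t : q̂ ℕ.< t) where

  private
    -- By `H-carry`, `g i - g 0` counts the elements of `H` in {1, ..., i}.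
    g : ℕ → ℕ
    g i = (ŝ ℕ.+ i ℕ.* q̂) ℕ./ t

    J : List ℕ
    J = H∩ ŝ q̂ t 0ℤ (+ t)

  H< : ℕ → List ℕ
  H< n = filter (H? ŝ q̂ t) (upTo n)

  H∩-0 : ∀ n → H∩ ŝ q̂ t 0ℤ (+ n) ≡ H< n
  H∩-0 n = cong (filter (H? ŝ q̂ t)) (range-0 n)

  -- This is `carry` for adding `q̂` to `ŝ + i q̂`. The condition defining `H` looks at the
  -- remainder after the addition, so the step from `i` to `suc i` is recorded at `suc i`.
  H-carry : ∀ i → (H ŝ q̂ t (suc i) × g (suc i) ≡ suc (g i)) ⊎ (¬ H ŝ q̂ t (suc i) × g (suc i) ≡ g i)
  H-carry i = subst
    (λ a → (a % t ℕ.< q̂ × a ℕ./ t ≡ suc (g i)) ⊎ (¬ a % t ℕ.< q̂ × a ℕ./ t ≡ g i))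
    (step ŝ (i ℕ.* q̂) q̂) (carry (ŝ ℕ.+ i ℕ.* q̂) q̂<t)
    where
    step : ∀ s x q → s ℕ.+ x ℕ.+ q ≡ s ℕ.+ (q ℕ.+ x)
    step = solve-∀

  residue-periodic : ∀ u k → (ŝ ℕ.+ (u ℕ.* t ℕ.+ k) ℕ.* q̂) % t ≡ (ŝ ℕ.+ k ℕ.* q̂) % t
  residue-periodic u k = trans (cong (_% t) (expand ŝ u t k q̂)) ([m+kn]%n≡m%n _ (u ℕ.* q̂) t)
    where
    expand : ∀ s u t k q → s ℕ.+ (u ℕ.* t ℕ.+ k) ℕ.* q ≡ s ℕ.+ k ℕ.* q ℕ.+ u ℕ.* q ℕ.* t
    expand = solve-∀

  H-periodic : ∀ u → (λ k → H ŝ q̂ t (u ℕ.* t ℕ.+ k)) ≐ H ŝ q̂ t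
  H-periodic u = (λ {k} → subst (ℕ._< q̂) (residue-periodic u k)) ,
                 (λ {k} → subst (ℕ._< q̂) (sym (residue-periodic u k)))

  filter-H-shift : ∀ u n → filter (H? ŝ q̂ t) (map (u ℕ.* t ℕ.+_) (upTo n)) ≡ map (u ℕ.* t ℕ.+_) (H< n)
  filter-H-shift u n = trans (filter-map (H? ŝ q̂ t) (u ℕ.* t ℕ.+_) (upTo n))
    (cong (map (u ℕ.* t ℕ.+_)) (filter-≐ (H? ŝ q̂ t ∘ (u ℕ.* t ℕ.+_)) (H? ŝ q̂ t) (H-periodic u) (upTo n)))

  -- Each element of `H` in {1, ..., n} raises `g` by one. No step leads into 0, so its possible
  -- membership is carried along as `length (H< 1)`; the additive form avoids subtraction.
  length-H<-suc : ∀ n → length (H< (suc n)) ℕ.+ g 0 ≡ length (H< 1) ℕ.+ g n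
  length-H<-suc zero    = refl
  length-H<-suc (suc n) with H-carry n
  ... | inj₁ (h , eq) = begin
    length (H< (2 ℕ.+ n)) ℕ.+ g 0            ≡⟨ cong (λ xs → length xs ℕ.+ g 0) (filter-upTo-accept (H? ŝ q̂ t) h) ⟩
    length (H< (suc n) ∷ʳ suc n) ℕ.+ g 0     ≡⟨ cong (ℕ._+ g 0) (length-++ (H< (suc n))) ⟩
    length (H< (suc n)) ℕ.+ 1 ℕ.+ g 0        ≡⟨ swap (length (H< (suc n))) (g 0) ⟩
    suc (length (H< (suc n)) ℕ.+ g 0)        ≡⟨ cong suc (length-H<-suc n) ⟩
    suc (length (H< 1) ℕ.+ g n)              ≡⟨ ℕ.+-suc (length (H< 1)) (g n) ⟨
    length (H< 1) ℕ.+ suc (g n)              ≡⟨ cong (length (H< 1) ℕ.+_) eq ⟨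
    length (H< 1) ℕ.+ g (suc n)              ∎
    where
    open ≡-Reasoning
    swap : ∀ a b → a ℕ.+ 1 ℕ.+ b ≡ suc (a ℕ.+ b)
    swap = solve-∀
  ... | inj₂ (¬h , eq) = begin
    length (H< (2 ℕ.+ n)) ℕ.+ g 0            ≡⟨ cong (λ xs → length xs ℕ.+ g 0) (filter-upTo-reject (H? ŝ q̂ t) ¬h) ⟩
    length (H< (suc n)) ℕ.+ g 0              ≡⟨ length-H<-suc n ⟩
    length (H< 1) ℕ.+ g n                    ≡⟨ cong (length (H< 1) ℕ.+_) eq ⟨
    length (H< 1) ℕ.+ g (suc n)              ∎
    where open ≡-Reasoning

  -- Take `length-H<-suc` at `n = t`. By periodicity `t` lies in `H` exactly when 0 does, so the two
  -- unknown memberships cancel, and what remains is the growth of `g` over a full period, which is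
  -- `q̂`.
  length-H<-t : length (H< t) ≡ q̂
  length-H<-t = ℕ.+-cancelʳ-≡ (length (H< 1) ℕ.+ g 0) (length (H< t)) q̂ (begin
    length (H< t) ℕ.+ (length (H< 1) ℕ.+ g 0)    ≡⟨ ℕ.+-assoc (length (H< t)) _ _ ⟨
    length (H< t) ℕ.+ length (H< 1) ℕ.+ g 0      ≡⟨ cong (ℕ._+ g 0) split ⟨
    length (H< (suc t)) ℕ.+ g 0                  ≡⟨ length-H<-suc t ⟩
    length (H< 1) ℕ.+ g t                        ≡⟨ cong (length (H< 1) ℕ.+_) gt ⟩
    length (H< 1) ℕ.+ (g 0 ℕ.+ q̂)                ≡⟨ rotate (length (H< 1)) (g 0) q̂ ⟩
    q̂ ℕ.+ (length (H< 1) ℕ.+ g 0)                ∎)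
    where
    open ≡-Reasoning
    rotate : ∀ a b c → a ℕ.+ (b ℕ.+ c) ≡ c ℕ.+ (a ℕ.+ b)
    rotate = solve-∀
    gt : g t ≡ g 0 ℕ.+ q̂
    gt = begin
      (ŝ ℕ.+ t ℕ.* q̂) ℕ./ t           ≡⟨ cong (λ x → (ŝ ℕ.+ x) ℕ./ t) (ℕ.*-comm t q̂) ⟩
      (ŝ ℕ.+ q̂ ℕ.* t) ℕ./ t           ≡⟨ [m+kn]/n≡m/n+k ŝ q̂ t ⟩
      ŝ ℕ./ t ℕ.+ q̂                   ≡⟨ cong (λ x → x ℕ./ t ℕ.+ q̂) (ℕ.+-identityʳ ŝ) ⟨
      g 0 ℕ.+ q̂                       ∎
    split : length (H< (suc t)) ≡ length (H< t) ℕ.+ length (H< 1)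
    split = begin
      -- Writing `t` as `1 ℕ.* t` puts the last index in the form that `filter-H-shift` expects.
      length (H< (suc t))                                        ≡⟨ cong (length ∘ H<) (trans (ℕ.+-comm 1 t) (cong (ℕ._+ 1) (sym (ℕ.*-identityˡ t)))) ⟩
      length (H< (1 ℕ.* t ℕ.+ 1))                                ≡⟨ cong length (filter-upTo-+ (H? ŝ q̂ t) (1 ℕ.* t) 1) ⟩
      length (H< (1 ℕ.* t) ++ filter (H? ŝ q̂ t) (map (1 ℕ.* t ℕ.+_) (upTo 1)))
        ≡⟨ length-++ (H< (1 ℕ.* t)) ⟩
      length (H< (1 ℕ.* t)) ℕ.+ length (filter (H? ŝ q̂ t) (map (1 ℕ.* t ℕ.+_) (upTo 1)))
        ≡⟨ cong₂ ℕ._+_ (cong (length ∘ H<) (ℕ.*-identityˡ t))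
                       (trans (cong length (filter-H-shift 1 1)) (length-map _ (H< 1))) ⟩
      length (H< t) ℕ.+ length (H< 1)                            ∎

  sum-H<-+ : ∀ u n → sum (H< (u ℕ.* t ℕ.+ n)) ≡
             sum (H< (u ℕ.* t)) ℕ.+ sum (filter (H? ŝ q̂ t) (map (u ℕ.* t ℕ.+_) (upTo n)))
  sum-H<-+ u n = trans (cong sum (filter-upTo-+ (H? ŝ q̂ t) (u ℕ.* t) n)) (sum-++ (H< (u ℕ.* t)) _)

  -- The period starting at `u t` contains the `q̂` elements of the first period, each raised by
  -- `u t`. The offsets 0, t, ..., (u - 1) t add up to `t * T u`.
  sum-H<-* : ∀ u → sum (H< (u ℕ.* t)) ≡ u ℕ.* sum (H< t) ℕ.+ q̂ ℕ.* t ℕ.* T u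
  sum-H<-* zero    = sym (ℕ.*-zeroʳ (q̂ ℕ.* t))
  sum-H<-* (suc u) = begin
    sum (H< (t ℕ.+ u ℕ.* t))                  ≡⟨ cong (sum ∘ H<) (ℕ.+-comm t (u ℕ.* t)) ⟩
    sum (H< (u ℕ.* t ℕ.+ t))                  ≡⟨ sum-H<-+ u t ⟩
    sum (H< (u ℕ.* t)) ℕ.+ sum (filter (H? ŝ q̂ t) (map (u ℕ.* t ℕ.+_) (upTo t)))
      ≡⟨ cong₂ ℕ._+_ (sum-H<-* u) (trans (cong sum (filter-H-shift u t)) (sum-map-+ (u ℕ.* t) (H< t))) ⟩
    u ℕ.* σ ℕ.+ q̂ ℕ.* t ℕ.* T u ℕ.+ (length (H< t) ℕ.* (u ℕ.* t) ℕ.+ σ)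
      ≡⟨ cong (λ l → u ℕ.* σ ℕ.+ q̂ ℕ.* t ℕ.* T u ℕ.+ (l ℕ.* (u ℕ.* t) ℕ.+ σ)) length-H<-t ⟩
    u ℕ.* σ ℕ.+ q̂ ℕ.* t ℕ.* T u ℕ.+ (q̂ ℕ.* (u ℕ.* t) ℕ.+ σ)
      ≡⟨ collect u σ q̂ t (T u) ⟩
    suc u ℕ.* σ ℕ.+ q̂ ℕ.* t ℕ.* T (suc u)     ∎
    where
    open ≡-Reasoning
    σ : ℕ
    σ = sum (H< t)
    collect : ∀ u σ q t T → u ℕ.* σ ℕ.+ q ℕ.* t ℕ.* T ℕ.+ (q ℕ.* (u ℕ.* t) ℕ.+ σ) ≡
                            suc u ℕ.* σ ℕ.+ q ℕ.* t ℕ.* (T ℕ.+ u)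
    collect = solve-∀

  enumerate-J : ∃ λ (j : Fin q̂ → ℕ) → j EnumeratesIncreasingly J
  enumerate-J = subst (λ xs → ∃ λ (j : Fin q̂ → ℕ) → j EnumeratesIncreasingly xs) (sym (H∩-0 t))
    (enumerate (AllPairs.filter⁺ _ (AllPairs.applyUpTo⁺₁ id t (λ i<j _ → i<j))) length-H<-t)

  module _ (1≤q̂ : 1 ℕ.≤ q̂) {j : Fin q̂ → ℕ} (enum : j EnumeratesIncreasingly J) where

    private
      first last : Fin q̂
      first = fromℕ< 1≤q̂
      last = opposite first

      ∈J⁺ : ∀ {k} → H ŝ q̂ t k → k ℕ.< t → k ∈ J
      ∈J⁺ h k<t = subst (_ ∈_) (sym (H∩-0 t)) (∈-filter⁺ (H? ŝ q̂ t) (∈-upTo⁺ k<t) h)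

    no-H-below-first : ∀ {k} → k ℕ.< j first → ¬ H ŝ q̂ t k
    no-H-below-first k<j₀ h = ℕ.<⇒≱ k<j₀ (first-min 1≤q̂ enum (∈J⁺ h (ℕ.<-trans k<j₀ j₀<t)))
      where
      j₀<t : j first ℕ.< t
      j₀<t = ∈-upTo⁻ (proj₁ (∈-filter⁻ (H? ŝ q̂ t) {xs = upTo t}
        (subst (j first ∈_) (H∩-0 t) (first-∈ 1≤q̂ enum))))

    sum-below-first : ∀ {M} → + j first ≥ M → + sum (H∩ ŝ q̂ t 0ℤ M) ≡ 0ℤ
    -- For a negative bound, `below` gives the empty list.
    sum-below-first { -[1+ _ ]} _         = refl
    sum-below-first {+ n} (ℤ.+≤+ n≤j₀) = cong +_ (trans (cong sum (H∩-0 n)) (cong sum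
      (filter-upTo-truncate (H? ŝ q̂ t) {0} {n} z≤n (λ k _ k<n → no-H-below-first (ℕ.<-≤-trans k<n n≤j₀)))))

    -- `M` may lie on either side of `t`. If `M ≤ t`, nothing of `H` lies in [M, t), since the last
    -- element of `J` is below `M`. If `t ≤ M`, an element in [t, M) would, moved down by `t`, fall
    -- below the first element of `H`.
    sum-one-period : ∀ {M} → + j last < M → + j first + + t ≥ M → sum (H∩ ŝ q̂ t 0ℤ M) ≡ sum J
    sum-one-period {+ n} (ℤ.+<+ j₁<n) (ℤ.+≤+ n≤j₀+t) =
      trans (cong sum (H∩-0 n)) (trans (cong sum H<n≡H<t) (cong sum (sym (H∩-0 t))))
      where
      above-last : ∀ k → n ℕ.≤ k → k ℕ.< t → ¬ H ŝ q̂ t k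
      above-last k n≤k k<t h = ℕ.<⇒≱ (ℕ.<-≤-trans j₁<n n≤k) (last-max 1≤q̂ enum (∈J⁺ h k<t))

      below-first+t : ∀ k → t ℕ.≤ k → k ℕ.< n → ¬ H ŝ q̂ t k
      below-first+t k t≤k k<n h = no-H-below-first {k ℕ.∸ t}
        (ℕ.+-cancelʳ-< t (k ℕ.∸ t) (j first)
          (subst (ℕ._< j first ℕ.+ t) (sym (ℕ.m∸n+n≡m t≤k)) (ℕ.<-≤-trans k<n n≤j₀+t)))
        (proj₁ (H-periodic 1) (subst (H ŝ q̂ t) k≡ h))
        where
        k≡ : k ≡ 1 ℕ.* t ℕ.+ (k ℕ.∸ t)
        k≡ = trans (sym (ℕ.m+[n∸m]≡n t≤k)) (cong (ℕ._+ (k ℕ.∸ t)) (sym (ℕ.*-identityˡ t)))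

      H<n≡H<t : H< n ≡ H< t
      H<n≡H<t = [ (λ n≤t → sym (filter-upTo-truncate (H? ŝ q̂ t) n≤t above-last))
                , (λ t≤n → filter-upTo-truncate (H? ŝ q̂ t) t≤n below-first+t) ]′ (ℕ.≤-total n t)

  -- The lower bound makes `M` positive, so {0, ..., M - 1} splits into `u` full periods, summed by
  -- `sum-H<-*`, and a last piece starting at `u t`.
  sum-periods : ∀ {i M} → + i < M →
    let u = floor ((M - 1ℤ) / t)
    in + sum (H∩ ŝ q̂ t 0ℤ M) ≡
       u * + sum J + + q̂ * + t * (((u - 1ℤ) * u) /ℕ 2) + + sum (H∩ ŝ q̂ t (u * + t) M)
  sum-periods {M = + zero}  (ℤ.+<+ ())
  -- Here `M - 1ℤ` computes to `+ m`. The annotation states the floor as the natural quotient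
  -- `m / t`, so that the triangular term becomes `T (m / t)` by the second rewrite.
  sum-periods {M = + suc m} _ rewrite (floor (+ m / t) ≡ + (m ℕ./ t)) ∋ floor-/ (+ m) t | [n-1]n/2≡T (m ℕ./ t) = begin
    + sum (H∩ ŝ q̂ t 0ℤ (+ suc m))
      ≡⟨ cong (λ xs → + sum xs) (H∩-0 (suc m)) ⟩
    + sum (H< (suc m))
      ≡⟨ cong (λ n → + sum (H< n)) M≡ ⟩
    + sum (H< (u ℕ.* t ℕ.+ r))
      ≡⟨ cong +_ (sum-H<-+ u r) ⟩
    + (sum (H< (u ℕ.* t)) ℕ.+ sum (filter (H? ŝ q̂ t) (map (u ℕ.* t ℕ.+_) (upTo r))))
      ≡⟨ cong₂ (λ x xs → + (x ℕ.+ sum xs)) (sum-H<-* u) K≡ ⟩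
    + (u ℕ.* sum (H< t)) + + (q̂ ℕ.* t ℕ.* T u) + + sum (H∩ ŝ q̂ t (+ u * + t) (+ suc m))
      ≡⟨ cong₂ (λ x y → x + y + + sum (H∩ ŝ q̂ t (+ u * + t) (+ suc m))) (ℤ.pos-* u (sum (H< t)))
           (trans (ℤ.pos-* (q̂ ℕ.* t) (T u)) (cong (_* + T u) (ℤ.pos-* q̂ t))) ⟩
    + u * + sum (H< t) + + q̂ * + t * + T u + + sum (H∩ ŝ q̂ t (+ u * + t) (+ suc m))
      ≡⟨ cong (λ xs → + u * + sum xs + + q̂ * + t * + T u + + sum (H∩ ŝ q̂ t (+ u * + t) (+ suc m))) (H∩-0 t) ⟨
    + u * + sum J + + q̂ * + t * + T u + + sum (H∩ ŝ q̂ t (+ u * + t) (+ suc m))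
      ∎
    where
    open ≡-Reasoning
    u r : ℕ
    u = m ℕ./ t
    -- As `u` is the quotient of `M - 1` rather than of `M`, the last piece has between 1 and `t`
    -- indices.
    r = suc (m % t)
    M≡ : suc m ≡ u ℕ.* t ℕ.+ r
    M≡ = trans (cong suc (m≡m%n+[m/n]*n m t)) (ℕ.+-comm r (u ℕ.* t))
    K≡ : filter (H? ŝ q̂ t) (map (u ℕ.* t ℕ.+_) (upTo r)) ≡ H∩ ŝ q̂ t (+ u * + t) (+ suc m)
    K≡ = trans (cong (filter (H? ŝ q̂ t)) (sym (range-+ (u ℕ.* t) r)))
      (cong₂ (H∩ ŝ q̂ t) (ℤ.pos-* u t) (cong +_ (sym M≡)))

-- The double count

-- c = ⌈(k t - s) / q⌉ for s < q, free of division and subtraction.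
Ceiling : (s t q k c : ℕ) → Set
Ceiling s t q k c = k ℕ.* t ℕ.≤ s ℕ.+ c ℕ.* q × s ℕ.+ c ℕ.* q ℕ.< k ℕ.* t ℕ.+ q

-- Division with remainder gives s + c q = k t + r with 0 ≤ r < q, which is exactly the pair of
-- inequalities in `Ceiling`. That `c` is a natural number comes from `s < q`.
floor-ceiling : ∀ s t q .{{_ : NonZero q}} → s ℕ.< q → ∀ k →
                ∃ λ c → floor ((+ s - + k * + t) / q) ≡ - + c × Ceiling s t q k c
floor-ceiling s t q s<q k = by-sign (floor (i / q)) refl
  where
  open ≡-Reasoning
  i : ℤ
  i = + s - + k * + t
  r : ℕ
  r = i ℤ.%ℕ q

  i≡ : ∀ {v} → floor (i / q) ≡ v → i ≡ + r + v * + q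
  i≡ {v} eq = trans (ℤ.a≡a%ℕn+[a/ℕn]*n i q)
    (cong (λ x → + r + x * + q) (trans (sym (floor-/ i q)) eq))

  s≡ : ∀ {v} → floor (i / q) ≡ v → + s ≡ + r + v * + q + + k * + t
  s≡ {v} eq = begin
    + s                        ≡⟨ add-sub (+ s) (+ k * + t) ⟩
    i + + k * + t              ≡⟨ cong (_+ + k * + t) (i≡ eq) ⟩
    + r + v * + q + + k * + t  ∎
    where
    add-sub : ∀ a b → a ≡ a - b + b
    add-sub = ℤ-Solver.solve-∀

  ceiling : ∀ c → floor (i / q) ≡ - + c → Ceiling s t q k c
  ceiling c eq =
    subst (k ℕ.* t ℕ.≤_) (sym s+cq) (ℕ.m≤m+n _ r) ,
    subst (ℕ._< k ℕ.* t ℕ.+ q) (sym s+cq) (ℕ.+-monoʳ-< (k ℕ.* t) (ℤ.n%ℕd<d i q))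
    where
    cancel : ∀ r c q kt → r + - c * q + kt + c * q ≡ kt + r
    cancel = ℤ-Solver.solve-∀
    s+cq : s ℕ.+ c ℕ.* q ≡ k ℕ.* t ℕ.+ r
    s+cq = ℤ.+-injective (begin
      + s + + (c ℕ.* q)                            ≡⟨ cong₂ _+_ (s≡ eq) (ℤ.pos-* c q) ⟩
      + r + - + c * + q + + k * + t + + c * + q    ≡⟨ cancel (+ r) (+ c) (+ q) (+ k * + t) ⟩
      + k * + t + + r                              ≡⟨ cong (_+ + r) (ℤ.pos-* k t) ⟨
      + (k ℕ.* t ℕ.+ r)                            ∎)

  by-sign : ∀ v → floor (i / q) ≡ v → ∃ λ c → floor (i / q) ≡ - + c × Ceiling s t q k c
  by-sign (+ zero)  eq = 0 , eq , ceiling 0 eq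
  by-sign -[1+ n ]  eq = suc n , eq , ceiling (suc n) eq
  -- A positive floor would make `s` at least `q`.
  by-sign (+ suc n) eq = contradiction q≤s (ℕ.<⇒≱ s<q)
    where
    s≡′ : s ≡ r ℕ.+ suc n ℕ.* q ℕ.+ k ℕ.* t
    s≡′ = ℤ.+-injective (trans (s≡ eq)
      (sym (cong₂ (λ x y → + r + x + y) (ℤ.pos-* (suc n) q) (ℤ.pos-* k t))))
    q≤s : q ℕ.≤ s
    q≤s = subst (q ℕ.≤_) (sym s≡′)
      (ℕ.≤-trans (ℕ.≤-trans (ℕ.m≤m+n q (n ℕ.* q)) (ℕ.m≤n+m _ r)) (ℕ.m≤m+n _ (k ℕ.* t)))

module _ {s t q : ℕ} .{{_ : NonZero t}} (t<q : t ℕ.< q) (c : ℕ → ℕ) (ceiling : ∀ k → Ceiling s t q k (c k)) where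

  private
    -- Since `c k ≤ i` holds exactly when `k t ≤ s + i q`, `f i` is the largest `k` with `c k ≤ i`.
    f : ℕ → ℕ
    f i = (s ℕ.+ i ℕ.* q) ℕ./ t

  ceiling-mono : ∀ k → c k ℕ.≤ c (suc k)
  ceiling-mono k = ℕ.≮⇒≥ λ c′<c → ℕ.<-irrefl refl (begin-strict
    suc k ℕ.* t ℕ.+ q                  ≤⟨ ℕ.+-monoˡ-≤ q (proj₁ (ceiling (suc k))) ⟩
    s ℕ.+ c (suc k) ℕ.* q ℕ.+ q        ≡⟨ rotate s (c (suc k) ℕ.* q) q ⟩
    s ℕ.+ suc (c (suc k)) ℕ.* q        ≤⟨ ℕ.+-monoʳ-≤ s (ℕ.*-monoˡ-≤ q c′<c) ⟩
    s ℕ.+ c k ℕ.* q                    <⟨ proj₂ (ceiling k) ⟩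
    k ℕ.* t ℕ.+ q                      ≤⟨ ℕ.+-monoˡ-≤ q (ℕ.m≤n+m (k ℕ.* t) t) ⟩
    suc k ℕ.* t ℕ.+ q                  ∎)
    where
    open ℕ.≤-Reasoning
    rotate : ∀ a b c → a ℕ.+ b ℕ.+ c ≡ a ℕ.+ (c ℕ.+ b)
    rotate = solve-∀

  -- Increasing `k` by one moves `k t` by `t < q`, too little to pass two multiples of `q`.
  ceiling-step : ∀ k → c (suc k) ℕ.≤ suc (c k)
  ceiling-step k = ℕ.≮⇒≥ λ 1+c<c′ → ℕ.<-irrefl refl (begin-strict
    k ℕ.* t ℕ.+ (q ℕ.+ q)                 ≤⟨ ℕ.+-monoˡ-≤ (q ℕ.+ q) (proj₁ (ceiling k)) ⟩
    s ℕ.+ c k ℕ.* q ℕ.+ (q ℕ.+ q)         ≡⟨ rotate s (c k ℕ.* q) q ⟩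
    s ℕ.+ suc (suc (c k)) ℕ.* q           ≤⟨ ℕ.+-monoʳ-≤ s (ℕ.*-monoˡ-≤ q 1+c<c′) ⟩
    s ℕ.+ c (suc k) ℕ.* q                 <⟨ proj₂ (ceiling (suc k)) ⟩
    t ℕ.+ k ℕ.* t ℕ.+ q                   ≤⟨ ℕ.+-monoˡ-≤ q (ℕ.+-monoˡ-≤ (k ℕ.* t) (ℕ.<⇒≤ t<q)) ⟩
    q ℕ.+ k ℕ.* t ℕ.+ q                   ≡⟨ swap q (k ℕ.* t) ⟩
    k ℕ.* t ℕ.+ (q ℕ.+ q)                 ∎)
    where
    open ℕ.≤-Reasoning
    rotate : ∀ a b c → a ℕ.+ b ℕ.+ (c ℕ.+ c) ≡ a ℕ.+ (c ℕ.+ (c ℕ.+ b))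
    rotate = solve-∀
    swap : ∀ a b → a ℕ.+ b ℕ.+ a ≡ b ℕ.+ (a ℕ.+ a)
    swap = solve-∀

  ceiling-0 : c 0 ≡ 0
  ceiling-0 = ℕ.n<1⇒n≡0 (ℕ.*-cancelʳ-< q (c 0) 1 (begin-strict
    c 0 ℕ.* q          ≤⟨ ℕ.m≤n+m (c 0 ℕ.* q) s ⟩
    s ℕ.+ c 0 ℕ.* q    <⟨ proj₂ (ceiling 0) ⟩
    q                  ≡⟨ ℕ.*-identityˡ q ⟨
    1 ℕ.* q            ∎))
    where open ℕ.≤-Reasoning

  -- At a jump, the upper bound on `c (suc k)` loses one `q` on each side and becomes s + c k · q <
  -- (k + 1) t; together with the lower bound on `c k` this pins the quotient to `k`.
  floor-at-jump : ∀ k → c (suc k) ≡ suc (c k) → f (c k) ≡ k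
  floor-at-jump k eq = proj₁ (divMod-unique k t r<t (sym (ℕ.m∸n+n≡m kt≤)))
    where
    open ℕ.≤-Reasoning
    kt≤ : k ℕ.* t ℕ.≤ s ℕ.+ c k ℕ.* q
    kt≤ = proj₁ (ceiling k)
    rotate : ∀ a b c → a ℕ.+ b ℕ.+ c ≡ a ℕ.+ (c ℕ.+ b)
    rotate = solve-∀
    <t+kt : s ℕ.+ c k ℕ.* q ℕ.< t ℕ.+ k ℕ.* t
    <t+kt = ℕ.+-cancelʳ-< q _ _ (begin-strict
      s ℕ.+ c k ℕ.* q ℕ.+ q      ≡⟨ rotate s (c k ℕ.* q) q ⟩
      s ℕ.+ suc (c k) ℕ.* q      ≡⟨ cong (λ x → s ℕ.+ x ℕ.* q) eq ⟨
      s ℕ.+ c (suc k) ℕ.* q      <⟨ proj₂ (ceiling (suc k)) ⟩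
      t ℕ.+ k ℕ.* t ℕ.+ q        ∎)
    r<t : s ℕ.+ c k ℕ.* q ℕ.∸ k ℕ.* t ℕ.< t
    r<t = ℕ.+-cancelʳ-< (k ℕ.* t) _ _ (begin-strict
      s ℕ.+ c k ℕ.* q ℕ.∸ k ℕ.* t ℕ.+ k ℕ.* t  ≡⟨ ℕ.m∸n+n≡m kt≤ ⟩
      s ℕ.+ c k ℕ.* q                          <⟨ <t+kt ⟩
      t ℕ.+ k ℕ.* t                            ∎)

  -- Induction on `N`, one column at a time. By `ceiling-mono` and `ceiling-step` the height stays
  -- at `M` or rises to `M + 1`. In the first case both sides grow by `M`; in the second a new row
  -- of length `f M = N` opens, and both sides grow by `M + 1 + N`.
  double-count : ∀ N → sumUpTo c (suc N) ℕ.+ sumUpTo f (c N) ≡ c N ℕ.* N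
  double-count zero rewrite ceiling-0 = refl
  double-count (suc N) = trans
    (cong (ℕ._+ sumUpTo f (c (suc N))) (sumUpTo-suc c (suc N)))
    ([ (λ c′≤c → stay (ℕ.≤-antisym c′≤c (ceiling-mono N)))
     , (λ c<c′ → jump (ℕ.≤-antisym (ceiling-step N) c<c′)) ]′ (ℕ.≤-<-connex (c (suc N)) (c N)))
    where
    open ≡-Reasoning
    C M : ℕ
    C = sumUpTo c (suc N)
    M = c N

    stay : c (suc N) ≡ M → C ℕ.+ c (suc N) ℕ.+ sumUpTo f (c (suc N)) ≡ c (suc N) ℕ.* suc N
    stay eq = begin
      C ℕ.+ c (suc N) ℕ.+ sumUpTo f (c (suc N))  ≡⟨ cong (λ m → C ℕ.+ m ℕ.+ sumUpTo f m) eq ⟩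
      C ℕ.+ M ℕ.+ sumUpTo f M                    ≡⟨ rotate C M (sumUpTo f M) ⟩
      M ℕ.+ (C ℕ.+ sumUpTo f M)                  ≡⟨ cong (M ℕ.+_) (double-count N) ⟩
      M ℕ.+ M ℕ.* N                              ≡⟨ ℕ.*-suc M N ⟨
      M ℕ.* suc N                                ≡⟨ cong (ℕ._* suc N) eq ⟨
      c (suc N) ℕ.* suc N                        ∎
      where
      rotate : ∀ C M F → C ℕ.+ M ℕ.+ F ≡ M ℕ.+ (C ℕ.+ F)
      rotate = solve-∀

    jump : c (suc N) ≡ suc M → C ℕ.+ c (suc N) ℕ.+ sumUpTo f (c (suc N)) ≡ c (suc N) ℕ.* suc N
    jump eq = begin
      C ℕ.+ c (suc N) ℕ.+ sumUpTo f (c (suc N))  ≡⟨ cong (λ m → C ℕ.+ m ℕ.+ sumUpTo f m) eq ⟩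
      C ℕ.+ suc M ℕ.+ sumUpTo f (suc M)
        ≡⟨ cong (C ℕ.+ suc M ℕ.+_) (trans (sumUpTo-suc f M) (cong (sumUpTo f M ℕ.+_) (floor-at-jump N eq))) ⟩
      C ℕ.+ suc M ℕ.+ (sumUpTo f M ℕ.+ N)        ≡⟨ rotate C M (sumUpTo f M) N ⟩
      C ℕ.+ sumUpTo f M ℕ.+ (suc M ℕ.+ N)        ≡⟨ cong (ℕ._+ (suc M ℕ.+ N)) (double-count N) ⟩
      M ℕ.* N ℕ.+ (suc M ℕ.+ N)                  ≡⟨ collect M N ⟩
      suc M ℕ.* suc N                            ≡⟨ cong (ℕ._* suc N) eq ⟨
      c (suc N) ℕ.* suc N                        ∎
      where
      rotate : ∀ C M F N → C ℕ.+ suc M ℕ.+ (F ℕ.+ N) ≡ C ℕ.+ F ℕ.+ (suc M ℕ.+ N)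
      rotate = solve-∀
      collect : ∀ M N → M ℕ.* N ℕ.+ (suc M ℕ.+ N) ≡ suc M ℕ.* suc N
      collect = solve-∀

-- Summation by parts

module _ (s t q q̄ q̂ s̄ ŝ : ℕ) .{{_ : NonZero t}} (q≡ : q ≡ q̄ ℕ.* t ℕ.+ q̂) (q̂<t : q̂ ℕ.< t)
         (s≡ : s ≡ s̄ ℕ.* t ℕ.+ ŝ) where

  private
    f g σ : ℕ → ℕ
    f i = (s ℕ.+ i ℕ.* q) ℕ./ t
    g i = (ŝ ℕ.+ i ℕ.* q̂) ℕ./ t
    σ n = sum (H< ŝ q̂ t q̂<t n)

  -- Splitting off the multiples of `t` leaves a part linear in `i`, so the irregularity of `f` is
  -- that of `g`.
  f≡g : ∀ i → f i ≡ g i ℕ.+ (s̄ ℕ.+ i ℕ.* q̄)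
  f≡g i = begin
    (s ℕ.+ i ℕ.* q) ℕ./ t                                      ≡⟨ cong₂ (λ s q → (s ℕ.+ i ℕ.* q) ℕ./ t) s≡ q≡ ⟩
    (s̄ ℕ.* t ℕ.+ ŝ ℕ.+ i ℕ.* (q̄ ℕ.* t ℕ.+ q̂)) ℕ./ t            ≡⟨ cong (ℕ._/ t) (collect s̄ ŝ q̄ q̂ t i) ⟩
    (ŝ ℕ.+ i ℕ.* q̂ ℕ.+ (s̄ ℕ.+ i ℕ.* q̄) ℕ.* t) ℕ./ t            ≡⟨ [m+kn]/n≡m/n+k (ŝ ℕ.+ i ℕ.* q̂) (s̄ ℕ.+ i ℕ.* q̄) t ⟩
    g i ℕ.+ (s̄ ℕ.+ i ℕ.* q̄)                                    ∎
    where
    open ≡-Reasoning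
    collect : ∀ s̄ ŝ q̄ q̂ t i → s̄ ℕ.* t ℕ.+ ŝ ℕ.+ i ℕ.* (q̄ ℕ.* t ℕ.+ q̂) ≡
                              ŝ ℕ.+ i ℕ.* q̂ ℕ.+ (s̄ ℕ.+ i ℕ.* q̄) ℕ.* t
    collect = solve-∀

  f-suc : ∀ {i e} → g (suc i) ≡ e ℕ.+ g i → f (suc i) ≡ e ℕ.+ (f i ℕ.+ q̄)
  f-suc {i} {e} eq = begin
    f (suc i)                                  ≡⟨ f≡g (suc i) ⟩
    g (suc i) ℕ.+ (s̄ ℕ.+ suc i ℕ.* q̄)          ≡⟨ cong (ℕ._+ (s̄ ℕ.+ suc i ℕ.* q̄)) eq ⟩
    e ℕ.+ g i ℕ.+ (s̄ ℕ.+ suc i ℕ.* q̄)          ≡⟨ collect e (g i) s̄ i q̄ ⟩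
    e ℕ.+ (g i ℕ.+ (s̄ ℕ.+ i ℕ.* q̄) ℕ.+ q̄)      ≡⟨ cong (λ x → e ℕ.+ (x ℕ.+ q̄)) (f≡g i) ⟨
    e ℕ.+ (f i ℕ.+ q̄)                          ∎
    where
    open ≡-Reasoning
    collect : ∀ e g s i q → e ℕ.+ g ℕ.+ (s ℕ.+ suc i ℕ.* q) ≡ e ℕ.+ (g ℕ.+ (s ℕ.+ i ℕ.* q) ℕ.+ q)
    collect = solve-∀

  -- The carry `e`, 0 or 1, governs both the step of `g` and the new term of `σ`. Packaging it as a
  -- number lets the induction below treat both cases at once.
  σ-suc : ∀ i → ∃ λ e → g (suc i) ≡ e ℕ.+ g i × σ (suc (suc i)) ≡ σ (suc i) ℕ.+ e ℕ.* suc i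
  σ-suc i with H-carry ŝ q̂ t q̂<t i
  ... | inj₁ (h , eq)  = 1 , eq , trans (cong sum (filter-upTo-accept (H? ŝ q̂ t) h))
    (trans (sum-∷ʳ (H< ŝ q̂ t q̂<t (suc i)) (suc i)) (cong (σ (suc i) ℕ.+_) (sym (ℕ.*-identityˡ (suc i)))))
  ... | inj₂ (¬h , eq) = 0 , eq , trans (cong sum (filter-upTo-reject (H? ŝ q̂ t) ¬h)) (sym (ℕ.+-identityʳ _))

  -- Abel summation: Σ_{i ≤ m} f i = (m + 1) f m - Σ_{1 ≤ i ≤ m} i (f i - f (i - 1)), where each
  -- difference is `q̄` plus the carry at `i`.
  summation-by-parts : ∀ m → sumUpTo f (suc m) ℕ.+ q̄ ℕ.* T (suc m) ℕ.+ σ (suc m) ≡ suc m ℕ.* f m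
  summation-by-parts zero = trans (cong (sumUpTo f 1 ℕ.+ q̄ ℕ.* 0 ℕ.+_) σ1≡0) (collect (f 0) q̄)
    where
    -- Whether or not 0 lies in `H`, it adds nothing to the sum.
    σ1≡0 : σ 1 ≡ 0
    σ1≡0 with does (H? ŝ q̂ t 0)
    ... | true  = refl
    ... | false = refl
    collect : ∀ f q → f ℕ.+ 0 ℕ.+ q ℕ.* 0 ℕ.+ 0 ≡ f ℕ.+ 0
    collect = solve-∀
  summation-by-parts (suc m) with e , g-eq , σ-eq ← σ-suc m = begin
    sumUpTo f (2 ℕ.+ m) ℕ.+ q̄ ℕ.* (T (suc m) ℕ.+ suc m) ℕ.+ σ (2 ℕ.+ m)
      ≡⟨ cong₂ (λ x y → x ℕ.+ q̄ ℕ.* (T (suc m) ℕ.+ suc m) ℕ.+ y) (sumUpTo-suc f (suc m)) σ-eq ⟩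
    sumUpTo f (suc m) ℕ.+ f (suc m) ℕ.+ q̄ ℕ.* (T (suc m) ℕ.+ suc m) ℕ.+ (σ (suc m) ℕ.+ e ℕ.* suc m)
      ≡⟨ regroup (sumUpTo f (suc m)) (f (suc m)) q̄ (T (suc m)) m (σ (suc m)) e ⟩
    f (suc m) ℕ.+ (sumUpTo f (suc m) ℕ.+ q̄ ℕ.* T (suc m) ℕ.+ σ (suc m) ℕ.+ suc m ℕ.* (e ℕ.+ q̄))
      ≡⟨ cong (λ x → f (suc m) ℕ.+ (x ℕ.+ suc m ℕ.* (e ℕ.+ q̄))) (summation-by-parts m) ⟩
    f (suc m) ℕ.+ (suc m ℕ.* f m ℕ.+ suc m ℕ.* (e ℕ.+ q̄))
      ≡⟨ factor (f (suc m)) m (f m) e q̄ ⟩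
    f (suc m) ℕ.+ suc m ℕ.* (e ℕ.+ (f m ℕ.+ q̄))
      ≡⟨ cong (λ x → f (suc m) ℕ.+ suc m ℕ.* x) (f-suc {m} g-eq) ⟨
    suc (suc m) ℕ.* f (suc m)
      ∎
    where
    open ≡-Reasoning
    regroup : ∀ F f q T m σ e → F ℕ.+ f ℕ.+ q ℕ.* (T ℕ.+ suc m) ℕ.+ (σ ℕ.+ e ℕ.* suc m) ≡
                                f ℕ.+ (F ℕ.+ q ℕ.* T ℕ.+ σ ℕ.+ suc m ℕ.* (e ℕ.+ q))
    regroup = solve-∀
    factor : ∀ f m f′ e q → f ℕ.+ (suc m ℕ.* f′ ℕ.+ suc m ℕ.* (e ℕ.+ q)) ≡ f ℕ.+ suc m ℕ.* (e ℕ.+ (f′ ℕ.+ q))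
    factor = solve-∀

  summation-by-parts-ℤ : ∀ M → + sumUpTo f M + + q̄ * + T M + + σ M ≡
                         + M * floor ((+ s + (+ M - 1ℤ) * + q) / t)
  -- The floor is taken here at row -1, but the factor `M = 0` removes it.
  summation-by-parts-ℤ zero = cong (λ x → 0ℤ + x + 0ℤ) (ℤ.*-zeroʳ (+ q̄))
  summation-by-parts-ℤ (suc m) = begin
    + F + + q̄ * + T (suc m) + + σ (suc m)           ≡⟨ cong (λ x → + F + x + + σ (suc m)) (ℤ.pos-* q̄ (T (suc m))) ⟨
    + (F ℕ.+ q̄ ℕ.* T (suc m) ℕ.+ σ (suc m))         ≡⟨ cong +_ (summation-by-parts m) ⟩
    + (suc m ℕ.* f m)                               ≡⟨ ℤ.pos-* (suc m) (f m) ⟩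
    + suc m * + f m                                 ≡⟨ cong (+ suc m *_) floor≡f ⟨
    + suc m * floor ((+ s + + m * + q) / t)         ∎
    where
    open ≡-Reasoning
    F : ℕ
    F = sumUpTo f (suc m)
    floor≡f : floor ((+ s + + m * + q) / t) ≡ + f m
    floor≡f = trans (floor-/ _ t) (cong (λ x → (+ s + x) /ℕ t) (sym (ℤ.pos-* m q)))

  S⁻-formula : .{{_ : NonZero q}} → s ℕ.< q → t ℕ.< q → ∀ N →
    let M = - floor ((+ s - + N * + t) / q)
    in S⁻ s t q N ≡
       - (+ q̄ * (((M - 1ℤ) * M) /ℕ 2)) - M * (+ N - floor ((+ s + (M - 1ℤ) * + q) / t))
       - + sum (H∩ ŝ q̂ t 0ℤ M)
  S⁻-formula s<q t<q N = begin
    S⁻ s t q N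
      ≡⟨ sumℤ-neg {c = c} (λ k → proj₁ (proj₂ (floor-ceiling s t q s<q k))) (upTo (suc N)) ⟩
    - + sumUpTo c (suc N)
      ≡⟨ solve-for-C (+ sumUpTo c (suc N)) (+ sumUpTo f (c N)) (+ q̄ * + T (c N)) (+ σ (c N)) (+ c N) (+ N) _
           (trans (cong +_ (double-count t<q c (λ k → proj₂ (proj₂ (floor-ceiling s t q s<q k))) N)) (ℤ.pos-* (c N) N))
           (summation-by-parts-ℤ (c N)) ⟩
    - (+ q̄ * + T (c N)) - + c N * (+ N - floor ((+ s + (+ c N - 1ℤ) * + q) / t)) - + σ (c N)
      ≡⟨ cong₂ (λ x xs → - (+ q̄ * x) - + c N * (+ N - floor ((+ s + (+ c N - 1ℤ) * + q) / t)) - + sum xs)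
           ([n-1]n/2≡T (c N)) (H∩-0 ŝ q̂ t q̂<t (c N)) ⟨
    rhs (+ c N)
      ≡⟨ cong rhs M≡c ⟨
    rhs (- floor ((+ s - + N * + t) / q))
      ∎
    where
    open ≡-Reasoning
    c : ℕ → ℕ
    c k = proj₁ (floor-ceiling s t q s<q k)
    M≡c : - floor ((+ s - + N * + t) / q) ≡ + c N
    M≡c = trans (cong -_ (proj₁ (proj₂ (floor-ceiling s t q s<q N)))) (ℤ.neg-involutive (+ c N))
    -- `M` is abstracted so that all its occurrences are exchanged for `+ c N` in one rewriting
    -- step.
    rhs : ℤ → ℤ
    rhs M = - (+ q̄ * (((M - 1ℤ) * M) /ℕ 2)) - M * (+ N - floor ((+ s + (M - 1ℤ) * + q) / t))
            - + sum (H∩ ŝ q̂ t 0ℤ M)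
    -- `C` is the sum over columns and `F` the sum over rows; `F` is eliminated between the double
    -- count and the summation by parts.
    solve-for-C : ∀ C F Q h M N x → C + F ≡ M * N → F + Q + h ≡ M * x → - C ≡ - Q - M * (N - x) - h
    solve-for-C C F Q h M N x C+F≡ F+Q+h≡ = begin
      - C                                ≡⟨ isolate C F Q h ⟩
      F + Q + h - Q - h - (C + F)        ≡⟨ cong₂ (λ a b → a - Q - h - b) F+Q+h≡ C+F≡ ⟩
      M * x - Q - h - M * N              ≡⟨ collect M x Q h N ⟩
      - Q - M * (N - x) - h              ∎
      where
      isolate : ∀ C F Q h → - C ≡ F + Q + h - Q - h - (C + F)
      isolate = ℤ-Solver.solve-∀
      collect : ∀ M x Q h N → M * x - Q - h - M * N ≡ - Q - M * (N - x) - h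
      collect = ℤ-Solver.solve-∀

-- Evaluation of the sum over `H` in the four cases

theorem12 : (s t q N : ℕ) .{{_ : NonZero t}} .{{_ : NonZero q}} →
    s ℕ.< q → t ℕ.< q → ¬ (t ∣ q) → gcd t q ≡ 1 →
    (q̄ q̂ s̄ ŝ : ℕ) →
    q ≡ q̄ ℕ.* t ℕ.+ q̂ → (1≤q̂ : 1 ℕ.≤ q̂) → q̂ ℕ.< t →
    s ≡ s̄ ℕ.* t ℕ.+ ŝ → ŝ ℕ.< t →
    let
      M : ℤ
      M = - floor ((+ s - + N * + t) / q)
      x-M : ℚᵘ
      x-M = (+ s + (M - 1ℤ) * + q) / t
      -- (M - 1) * M and (u - 1) * u are even, so halving them is exact
      S : ℤ
      S = - (+ q̄ * (((M - 1ℤ) * M) /ℕ 2)) - M * (+ N - floor x-M)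
      J : List ℕ
      J = H∩ ŝ q̂ t 0ℤ (+ t)
      first : Fin q̂
      first = fromℕ< 1≤q̂
      last : Fin q̂
      last = opposite first
    in
    ∃ λ (j : Fin q̂ → ℕ) → (j EnumeratesIncreasingly J)
      × (+ j first ≥ M → S⁻ s t q N ≡ S)
      × (+ j first < M → M ≤ + j last →
           let K = H∩ ŝ q̂ t 0ℤ M in
           S⁻ s t q N ≡ S - + sum K)
      × (+ j last < M → + j first + + t ≥ M →
           S⁻ s t q N ≡ S - + sum J)
      × (+ j last < M → + j first + + t < M →
           let u = floor ((M - 1ℤ) / t)
               K = H∩ ŝ q̂ t (u * + t) M in
           S⁻ s t q N ≡ S - u * + sum J - + q̂ * + t * (((u - 1ℤ) * u) /ℕ 2) - + sum K)
theorem12 s t q N s<q t<q _ _ q̄ q̂ s̄ ŝ q≡ 1≤q̂ q̂<t s≡ _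
  with j , enum ← enumerate-J ŝ q̂ t q̂<t =
  j , enum
  , (λ j₀≥M → trans (evaluate (sum-below-first ŝ q̂ t q̂<t 1≤q̂ enum j₀≥M)) (ℤ.+-identityʳ S))
  -- In this case `K` is the whole of `H` below `M`, so the general formula is already the claim.
  , (λ _ _ → evaluate refl)
  , (λ j₁<M M≤j₀+t → evaluate (cong +_ (sum-one-period ŝ q̂ t q̂<t 1≤q̂ enum j₁<M M≤j₀+t)))
  , (λ j₁<M _ → trans (evaluate (sum-periods ŝ q̂ t q̂<t j₁<M))
      (distribute S (u * + sum (H∩ ŝ q̂ t 0ℤ (+ t))) (+ q̂ * + t * (((u - 1ℤ) * u) /ℕ 2)) (+ sum (H∩ ŝ q̂ t (u * + t) M))))
  where
  M S u : ℤ
  M = - floor ((+ s - + N * + t) / q)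
  S = - (+ q̄ * (((M - 1ℤ) * M) /ℕ 2)) - M * (+ N - floor ((+ s + (M - 1ℤ) * + q) / t))
  u = floor ((M - 1ℤ) / t)
  evaluate : ∀ {x} → + sum (H∩ ŝ q̂ t 0ℤ M) ≡ x → S⁻ s t q N ≡ S - x
  evaluate eq = trans (S⁻-formula s t q q̄ q̂ s̄ ŝ q≡ q̂<t s≡ s<q t<q N) (cong (λ x → S - x) eq)
  distribute : ∀ a b c d → a - (b + c + d) ≡ a - b - c - d
  distribute = ℤ-Solver.solve-∀
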